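{- Let $D$ be a partial layer decomposition (PLD) of a DAG $G$. Let $X$ be a variable of $G$ such that $X\notin\mathrm{Vars}(D)$ but such that at least one child $Y$ of $X$ in $G$ is a member of $\mathrm{Vars}(D)$. Let $D'=((T^0,S^0),\dots,(T^k,S^k))$ be any layer decomposition of $G$ such that $D$ is a sub-PLD of $D'$. Then if $Y\in S^i$ for some $i\in\{0,\dots,k-1\}$, then $X\in T^{i+1}$. Otherwise, if $Y\in T^i\setminus S^i$ for some $i\in\{0,\dots,k\}$, then $X\in T^i$.
   Context: All graphs are finite. A layer decomposition of a DAG $G=(V,A)$ is a list $((T^0,S^0),\dots,(T^k,S^k))$ of pairs of subsets of $V$ such that: (D1) $(T^0,\dots,T^k)$ is an ordered partition of $V$ (into nonempty blocks); (D2) $S^i\subseteq T^i$ for every $i\in\{0,\dots,k\}$; (D3) for every $i\in\{0,\dots,k-1\}$, no two variables $X\in T^0\cup\dots\cup T^{i-1}\cup(T^i\setminus S^i)$ and $Y\in T^{i+1}\cup\dots\cup T^k$ are connected by an arrow in $G$; (D4) for every $i\in\{1,\dots,k\}$, every child in $G$ of a variable in $S^i$ belongs to $(T^i\setminus S^i)\cup S^{i-1}$, and every child of a variable in $S^0$ belongs to $T^0\setminus S^0$; (D5) for every $i\in\{0,\dots,k-1\}$, every parent in $G$ of a variable in $S^i$ belongs to $T^{i+1}$, and no variable in $S^k$ has a parent. For $W\subseteq V$, $G[W]$ is the subgraph of $G$ induced on $W$. A partial layer decomposition (PLD) $D$ of $G$ is a layer decomposition of $G[W]$ for some $W\subseteq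 V$; then $\mathrm{Vars}(D)=W$. In particular, a layer decomposition of $G$ is a PLD with $\mathrm{Vars}(D)=V$. Let $D=((T_1^0,S_1^0),\dots,(T_1^k,S_1^k))$ and $D'=((T_2^0,S_2^0),\dots,(T_2^j,S_2^j))$ be PLDs of $G$ with $\mathrm{Vars}(D')\subseteq\mathrm{Vars}(D)$. $D'$ is a sub-PLD of $D$ iff there is a non-negative integer $m$ such that for all $i\in\{0,\dots,j\}$: $T_2^i\subseteq T_1^{i+m}$, $S_2^i\subseteq S_1^{i+m}$ and $T_2^i\setminus S_2^i\subseteq T_1^{i+m}\setminus S_1^{i+m}$. -}

module Defs where

open import Data.Fin.Base using (Fin; zero; suc; toℕ; inject₁; fromℕ; _<_)
open import Data.Fin.Subset using (Subset; _∈_; _⊆_; _∪_; _∩_; _─_; Nonempty; Empty)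
open import Data.Nat.Base using (ℕ; _+_)
open import Data.Product.Base using (∃-syntax; _×_; _,_; proj₁; proj₂)
open import Data.Sum.Base using (_⊎_; inj₁; inj₂)
open import Function.Base using (id; _∘_)
open import Function.Bundles using (_⇔_)
open import Level using (0ℓ)
open import Relation.Binary.Construct.Closure.Transitive using (TransClosure; _∷_) renaming ([_] to single)
open import Relation.Binary.Core using (Rel; _⇒_)
open import Relation.Binary.PropositionalEquality.Core using (_≡_; _≢_)
open import Relation.Nullary.Negation.Core using (¬_)

-- Vertices are named by elements of Fin n, but only those in V belong to the
-- graph. In this way an induced subgraph is again a DAG over the same names.
record DAG (n : ℕ) : Set₁ where
  infix 4 _⟶_
  field
    V       : Subset n
    _⟶_     : Rel (Fin n) 0ℓ
    source  : ∀ {x y} → x ⟶ y → x ∈ V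
    target  : ∀ {x y} → x ⟶ y → y ∈ V
    acyclic : ∀ {x} → ¬ TransClosure _⟶_ x x

TransClosure-mono : ∀ {A : Set} {R S : Rel A 0ℓ} →
                    R ⇒ S → TransClosure R ⇒ TransClosure S
TransClosure-mono f (single r) = single (f r)
TransClosure-mono f (r ∷ rs)   = f r ∷ TransClosure-mono f rs

infix 8 _[_]

-- Meaningful as a subgraph of G only when W ⊆ V, as required in PLD below.
_[_] : ∀ {n} → DAG n → Subset n → DAG n
G [ W ] = record
  { V       = W
  ; _⟶_     = λ x y → x ∈ W × y ∈ W × x ⟶ y
  ; source  = proj₁
  ; target  = proj₁ ∘ proj₂
  ; acyclic = acyclic ∘ TransClosure-mono (proj₂ ∘ proj₂)
  }
  where open DAG G

record Layers (n : ℕ) : Set where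
  field
    k   : ℕ
    T S : Fin (ℕ.suc k) → Subset n

-- For i : Fin k, the positions i and i + 1 of Fin (suc k) are written
-- inject₁ i and suc i, and the last position k is fromℕ k.
record IsLayerDecomposition {n} (G : DAG n) (L : Layers n) : Set where
  open DAG G
  open Layers L
  field
    D1-nonempty : ∀ i → Nonempty (T i)
    D1-disjoint : ∀ i j → i ≢ j → Empty (T i ∩ T j)
    D1-covers   : ∀ x → x ∈ V ⇔ (∃[ i ] x ∈ T i)

    D2 : ∀ i → S i ⊆ T i

    D3 : ∀ (i : Fin k) x y →
         (∃[ l ] l < inject₁ i × x ∈ T l) ⊎ x ∈ T (inject₁ i) ─ S (inject₁ i) →
         (∃[ l ] inject₁ i < l × y ∈ T l) →
         ¬ (x ⟶ y ⊎ y ⟶ x)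

    D4-suc  : ∀ (i : Fin k) x y → x ∈ S (suc i) → x ⟶ y →
              y ∈ (T (suc i) ─ S (suc i)) ∪ S (inject₁ i)
    D4-zero : ∀ x y → x ∈ S zero → x ⟶ y → y ∈ T zero ─ S zero

    D5-inject : ∀ (i : Fin k) x y → y ∈ S (inject₁ i) → x ⟶ y → x ∈ T (suc i)
    D5-last   : ∀ x y → y ∈ S (fromℕ k) → ¬ (x ⟶ y)

record LayerDecomposition {n} (G : DAG n) : Set where
  field
    layers               : Layers n
    isLayerDecomposition : IsLayerDecomposition G layers
  open Layers layers public
  open IsLayerDecomposition isLayerDecomposition public

record PLD {n} (G : DAG n) : Set where
  field
    Vars          : Subset n
    Vars⊆V        : Vars ⊆ DAG.V G
    decomposition : LayerDecomposition (G [ Vars ])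
  open LayerDecomposition decomposition public

-- The arrows of G [ V ] are those of G bundled with proofs that their ends lie
-- in V, so a layer decomposition of G has to be transported to G [ V ].
toPLD : ∀ {n} {G : DAG n} → LayerDecomposition G → PLD G
toPLD {G = G} D = record
  { Vars          = V
  ; Vars⊆V        = id
  ; decomposition = record
    { layers               = layers
    ; isLayerDecomposition = record
      { D1-nonempty = D1-nonempty
      ; D1-disjoint = D1-disjoint
      ; D1-covers   = D1-covers
      ; D2          = D2
      ; D3          = λ { i x y p q (inj₁ (_ , _ , a)) → D3 i x y p q (inj₁ a)
                        ; i x y p q (inj₂ (_ , _ , a)) → D3 i x y p q (inj₂ a) }
      ; D4-suc      = λ { i x y p (_ , _ , a) → D4-suc i x y p a }
      ; D4-zero     = λ { x y p (_ , _ , a) → D4-zero x y p a }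
      ; D5-inject   = λ { i x y p (_ , _ , a) → D5-inject i x y p a }
      ; D5-last     = λ { x y p (_ , _ , a) → D5-last x y p a }
      }
    }
  }
  where
  open DAG G
  open LayerDecomposition D

infix 4 _IsSubPLDOf_

-- The position i + m is required to exist in D, as its use as an index demands.
_IsSubPLDOf_ : ∀ {n} {G : DAG n} → PLD G → PLD G → Set
D′ IsSubPLDOf D =
  D′.Vars ⊆ D.Vars ×
  (∃[ m ] ∀ i → ∃[ i+m ]
    toℕ i+m ≡ toℕ i + m ×
    D′.T i ⊆ D.T i+m ×
    D′.S i ⊆ D.S i+m ×
    D′.T i ─ D′.S i ⊆ D.T i+m ─ D.S i+m)
  where
  module D  = PLD D
  module D′ = PLD D′

{-# OPTIONS --safe #-}
module Submission where

open import Defs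
open import Data.Fin.Base using (Fin; zero; suc; inject₁; _<_; _≤_)
open import Data.Fin.Properties using (_≟_; <-cmp; ≤fromℕ; ≤̄⇒inject₁<)
open import Data.Fin.Relation.Unary.Top using (view; ‵fromℕ; ‵inject₁)
open import Data.Fin.Subset using (_∈_; _∉_; _─_)
open import Data.Fin.Subset.Properties
  using (_∈?_; x∈p∩q⁺; x∈p∪q⁻; p─q⊆p; x∈p∧x∉q⇒x∈p─q)
open import Data.Nat.Base using (ℕ)
open import Data.Nat.Properties using (≤-refl; <⇒≤; <⇒≱)
open import Data.Product.Base using (_×_; _,_; ∃-syntax)
open import Data.Sum.Base using (_⊎_; inj₁; inj₂)
open import Function.Bundles using (Equivalence)
open import Relation.Binary.Definitions using (tri<; tri≈; tri>)
open import Relation.Binary.PropositionalEquality.Core using (_≡_; refl)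
open import Relation.Nullary.Decidable using (yes; no; decidable-stable)
open import Relation.Nullary.Negation using (¬_; contradiction)

-- Let Y ∈ Tⁱ ∖ Sⁱ and let Tʲ be the block of its parent X. If i < j, the arrow
-- X ⟶ Y contradicts D3 at i; if j < i, it contradicts D3 at j when X ∉ Sʲ, and
-- D4 at j when X ∈ Sʲ. The case Y ∈ Sⁱ is D5.

module _ {n} {G : DAG n} (D : LayerDecomposition G) where
  open DAG G
  open LayerDecomposition D

  block-unique : ∀ {x i j} → x ∈ T i → x ∈ T j → i ≡ j
  block-unique {x} {i} {j} x∈Ti x∈Tj = decidable-stable (i ≟ j)
    λ i≢j → D1-disjoint i j i≢j (x , x∈p∩q⁺ (x∈Ti , x∈Tj))

  T─S-not-adjacent-above : ∀ {i j x y} → i < j → x ∈ T i ─ S i → y ∈ T j →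
                           ¬ (x ⟶ y ⊎ y ⟶ x)
  T─S-not-adjacent-above {i} {j} i<j x∈Ti─Si y∈Tj with view i
  -- D3 is stated only for positions before the last. The last position cannot occur here, as no `j`
  -- lies above it.
  ... | ‵fromℕ      = contradiction (≤fromℕ j) (<⇒≱ i<j)
  ... | ‵inject₁ i′ = D3 i′ _ _ (inj₂ x∈Ti─Si) (j , i<j , y∈Tj)

  -- D4 sends a child of `S j` either to `T j ─ S j` or to `S` of the preceding block, and it allows
  -- no other place.
  S-child-below : ∀ {j x y} → x ∈ S j → x ⟶ y → ∃[ l ] l ≤ j × y ∈ T l
  S-child-below {zero} x∈S x⟶y =
    zero , ≤-refl , p─q⊆p (T zero) (S zero) (D4-zero _ _ x∈S x⟶y)
  S-child-below {suc j} x∈S x⟶y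
    with x∈p∪q⁻ (T (suc j) ─ S (suc j)) (S (inject₁ j)) (D4-suc j _ _ x∈S x⟶y)
  ... | inj₁ y∈T─S = suc j , ≤-refl , p─q⊆p (T (suc j)) (S (suc j)) y∈T─S
  ... | inj₂ y∈S   =
    inject₁ j , <⇒≤ (≤̄⇒inject₁< {i = j} ≤-refl) , D2 (inject₁ j) y∈S

  -- D3 at `j` is silent about arrows that leave `S j`; D4 fills this gap.
  child-not-above : ∀ {i j x y} → x ∈ T j → y ∈ T i → x ⟶ y → ¬ j < i
  child-not-above {i} {j} {x} x∈Tj y∈Ti x⟶y j<i with x ∈? S j
  ... | no x∉S = T─S-not-adjacent-above j<i (x∈p∧x∉q⇒x∈p─q x∈Tj x∉S) y∈Ti (inj₁ x⟶y)
  ... | yes x∈S with S-child-below x∈S x⟶y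
  ...   | l , l≤j , y∈Tl with block-unique y∈Ti y∈Tl
  -- The blocks are disjoint, so `l` has become `i`, and `l≤j` now contradicts `j<i`.
  ...     | refl = <⇒≱ j<i l≤j

  T─S-parent-in-block : ∀ {i x y} → y ∈ T i ─ S i → x ⟶ y → x ∈ T i
  T─S-parent-in-block {i} {x} y∈Ti─Si x⟶y
    with Equivalence.to (D1-covers x) (source x⟶y)
  ... | j , x∈Tj with <-cmp i j
  -- `y` is in the lower block here, so it takes the first role in D3 and the arrow `x ⟶ y` enters
  -- as the reversed alternative.
  ...   | tri< i<j _ _  = contradiction (inj₂ x⟶y) (T─S-not-adjacent-above i<j y∈Ti─Si x∈Tj)
  ...   | tri≈ _ refl _ = x∈Tj
  ...   | tri> _ _ j<i  =
    contradiction j<i (child-not-above x∈Tj (p─q⊆p (T i) (S i) y∈Ti─Si) x⟶y)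

theorem8 : ∀ {n : ℕ} (G : DAG n) (D : PLD G) (X : Fin n) →
    X ∈ DAG.V G → X ∉ PLD.Vars D →
    ∀ (Y : Fin n) → DAG._⟶_ G X Y → Y ∈ PLD.Vars D →
    ∀ (D′ : LayerDecomposition G) → D IsSubPLDOf toPLD D′ →
    let open LayerDecomposition D′ in
    (∀ (i : Fin k) → Y ∈ S (inject₁ i) → X ∈ T (suc i)) ×
    (∀ (i : Fin (ℕ.suc k)) → Y ∈ T i ─ S i → X ∈ T i)
theorem8 G D X _ _ Y X⟶Y _ D′ _ =
  (λ i Y∈S → D5-inject i X Y Y∈S X⟶Y) ,
  (λ i Y∈T─S → T─S-parent-in-block D′ Y∈T─S X⟶Y)
  where open LayerDecomposition D′
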